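{- Let $n\ge 1$ and $t\ge 0$ be integers. The number of permutations $\pi\in S_n$ that are $t$-stack-sortable under $s_{1\dot{2}}$ equals $n!$ if $n\le t$, and equals $t!\cdot (t+1)^{\,n-t}$ if $n>t$.
   Context: The $1\dot{2}$-avoiding stack-sorting map $s_{1\dot{2}}$ is defined as follows. Start with the input $\pi$ and an empty stack. Repeat the following step until both the input and the stack are empty: - If input remains, and either the stack is empty or the next input entry is smaller than the entry at the bottom of the stack, push the next input entry onto the top of the stack. - Otherwise, pop the top entry of the stack and append it to the output. The output word is $s_{1\dot{2}}(\pi)$. For an integer $t\ge 0$, a permutation $\pi\in S_n$ is called $t$-stack-sortable (under $s_{1\dot{2}}$) if $s_{1\dot{2}}^{\,t}(\pi)$, the $t$-fold iterate applied to $\pi$, equals the identity $12\cdots n$. -}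

module Defs where

open import Data.Bool.Base using (if_then_else_)
open import Data.Fin.Base using (Fin)
open import Data.Fin.Permutation using (Permutation′; _⟨$⟩ʳ_; _≈_)
open import Data.Fin.Properties using (_<?_)
open import Data.List.Base using (List; []; _∷_; tabulate; allFin)
open import Data.Nat.Base using (ℕ)
open import Data.Nat.GeneralisedArithmetic using (fold)
open import Data.Product.Base using (Σ; proj₁)
open import Function.Bundles using (Inverse)
open import Level using (Level; 0ℓ)
open import Relation.Binary.Bundles using (Setoid)
open import Relation.Binary.PropositionalEquality using (_≡_; refl; sym; trans; setoid)
open import Relation.Nullary.Decidable.Core using (⌊_⌋)
import Relation.Binary.Construct.On as On

private
  variable
    c ℓ : Level
    A : Set c
    n : ℕ

-- A stack is a list whose head is its top; a nonempty one is given here by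
-- its top entry and the rest.
bottom : A → List A → A
bottom x []       = x
bottom _ (y ∷ ys) = bottom y ys

-- run input stack: what the machine still appends to its output from the
-- given configuration.
run : List (Fin n) → List (Fin n) → List (Fin n)
run []       []       = []
run []       (y ∷ ys) = y ∷ run [] ys
run (x ∷ xs) []       = run xs (x ∷ [])
run (x ∷ xs) (y ∷ ys) =
  if ⌊ x <? bottom y ys ⌋
  then run xs (x ∷ y ∷ ys)
  else y ∷ run (x ∷ xs) ys

-- The map s_{1\dot{2}}.
stackSort : List (Fin n) → List (Fin n)
stackSort w = run w []

-- One-line notation, with Fin n = {0, …, n-1} in place of {1, …, n}; the
-- identity is allFin n.
oneLine : Permutation′ n → List (Fin n)
oneLine π = tabulate (π ⟨$⟩ʳ_)

StackSortable : ℕ → Permutation′ n → Set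
StackSortable {n} t π = fold (oneLine π) stackSort t ≡ allFin n

permutationSetoid : ℕ → Setoid 0ℓ 0ℓ
permutationSetoid n = record
  { Carrier       = Permutation′ n
  ; _≈_           = _≈_
  ; isEquivalence = record
    { refl  = λ _ → refl
    ; sym   = λ π≈ρ i → sym (π≈ρ i)
    ; trans = λ π≈ρ ρ≈σ i → trans (π≈ρ i) (ρ≈σ i)
    }
  }

-- Elements are compared as permutations; the proof of sortability is ignored,
-- so that this is a subset of S_n.
sortableSetoid : (n t : ℕ) → Setoid 0ℓ 0ℓ
sortableSetoid n t =
  On.setoid {B = Σ (Permutation′ n) (StackSortable t)} (permutationSetoid n) proj₁

HasCardinality : Setoid c ℓ → ℕ → Set _
HasCardinality S N = Inverse (setoid (Fin N)) S

{-# OPTIONS --safe #-}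

-- Deleting the smallest letter 0 commutes with s. If w splits at its
-- left-to-right maxima into blocks m B, then s reverses each B and puts it
-- before m; hence s carries the positions 1, …, |w| at which 0 may be inserted
-- in w bijectively to the positions 0, …, |w|-1 of s(w), and fixes position 0.
-- Numbering the positions by the number of steps 0 needs to reach the front
-- gives a code c₁ … cₙ of permutations (0 ≤ cᵢ < i) on which s acts by
-- cᵢ ↦ max(cᵢ - 1, 0). So π is t-stack-sortable iff all cᵢ ≤ t, and there are
-- ∏ᵢ min(i, t+1) such codes.

module Submission where

open import Defs
open import Data.Bool.Base using (if_then_else_)
open import Data.Fin.Base as Fin using (Fin; toℕ; fromℕ<; punchIn; punchOut; combine; remQuot)
open import Data.Fin.Permutation as Perm using (Permutation′; _⟨$⟩ʳ_; _⟨$⟩ˡ_; _≈_)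
open import Data.Fin.Properties as Fin using (_<?_)
open import Data.List.Base using (List; []; _∷_; [_]; _++_; _ʳ++_; length; map; tabulate; allFin)
open import Data.List.Properties using (∷-injective; map-tabulate; tabulate-cong; length-map; map-++; map-injective)
open import Data.List.Relation.Unary.All as All using (All; []; _∷_)
import Data.List.Relation.Unary.All.Properties as All
open import Data.Nat.Base using (ℕ; zero; suc; pred; z≤n; s≤s; s≤s⁻¹; _+_; _*_; _∸_; _⊓_; _^_; _!; _≤_; _<_)
open import Data.Nat.GeneralisedArithmetic using (fold)
open import Data.Nat.Properties hiding (_<?_; _≟_)
open import Data.Product.Base using (_×_; _,_; ∃; proj₁; proj₂)
open import Data.Vec.Base as Vec using (Vec; []; _∷_)
import Data.Vec.Properties as Vec
open import Function.Base using (id; _∘_)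
open import Function.Definitions using (Injective)
open import Function.Properties.Bijection using (Bijection⇒Inverse)
open import Relation.Binary.PropositionalEquality hiding ([_])
open import Relation.Nullary using (yes; no; contradiction)
open import Relation.Nullary.Decidable.Core using (⌊_⌋)

private
  variable
    m n : ℕ

-- The block structure of the stack-sorting map

-- Only the first letter counts: it alone decides whether a stack with bottom `m` is emptied before
-- the machine reads on.
data NotBelow (m : Fin n) : List (Fin n) → Set where
  []  : NotBelow m []
  _∷_ : ∀ {x} → m Fin.≤ x → (xs : List (Fin n)) → NotBelow m (x ∷ xs)

zero-notBelow : ∀ (xs : List (Fin (suc n))) → NotBelow Fin.zero xs
zero-notBelow []       = []
zero-notBelow (x ∷ xs) = z≤n ∷ xs

bottom-++ : ∀ (y : Fin n) ys m → bottom y (ys ++ [ m ]) ≡ m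
bottom-++ y []       m = refl
bottom-++ _ (y ∷ ys) m = bottom-++ y ys m

run-push : ∀ {x m : Fin n} xs B → x Fin.< m →
           run (x ∷ xs) (B ++ [ m ]) ≡ run xs (x ∷ B ++ [ m ])
run-push {x = x} {m} xs [] x<m with x <? m
... | yes _  = refl
... | no x≮m = contradiction x<m x≮m
run-push {x = x} {m} xs (b ∷ B) x<m with x <? bottom b (B ++ [ m ])
... | yes _  = refl
... | no x≮m = contradiction (subst (x Fin.<_) (sym (bottom-++ b B m)) x<m) x≮m

-- Popping leaves the bottom `m` in place until the very end, so the same comparison fails each
-- time.
run-pop : ∀ {m : Fin n} {xs} B → NotBelow m xs → run xs (B ++ [ m ]) ≡ B ++ m ∷ run xs []
run-pop []      [] = refl
run-pop (b ∷ B) [] = cong (b ∷_) (run-pop B [])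
run-pop {m = m} [] (_∷_ {x} m≤x xs) with x <? m
... | yes x<m = contradiction m≤x (<⇒≱ x<m)
... | no _    = refl
run-pop {m = m} (b ∷ B) (_∷_ {x} m≤x xs) with x <? bottom b (B ++ [ m ])
... | yes x<m = contradiction m≤x (<⇒≱ (subst (x Fin.<_) (bottom-++ b B m) x<m))
... | no _    = cong (b ∷_) (run-pop B (m≤x ∷ xs))

run-block : ∀ {m : Fin n} xs B → All (Fin._< m) B → run (B ʳ++ xs) [ m ] ≡ run xs (B ++ [ m ])
run-block xs []      []           = refl
run-block xs (b ∷ B) (b<m ∷ B<m) = trans (run-block (b ∷ xs) B B<m) (run-push xs B b<m)

-- `B` lists the block as it lies on the stack, top first, hence its reversal in the input.
stackSort-block : ∀ {m : Fin n} {xs} B → All (Fin._< m) B → NotBelow m xs →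
                  stackSort (m ∷ B ʳ++ xs) ≡ B ++ m ∷ stackSort xs
stackSort-block {xs = xs} B B<m m≤xs = trans (run-block xs B B<m) (run-pop B m≤xs)

-- Invariance under relabelling by `suc`

bottom-map-suc : ∀ (y : Fin n) ys → bottom (Fin.suc y) (map Fin.suc ys) ≡ Fin.suc (bottom y ys)
bottom-map-suc y []       = refl
bottom-map-suc _ (y ∷ ys) = bottom-map-suc y ys

if-below-map-suc : ∀ (x y : Fin n) ys {v w : List (Fin n)} {v′ w′} → v′ ≡ map Fin.suc v → w′ ≡ map Fin.suc w →
  (if ⌊ Fin.suc x <? bottom (Fin.suc y) (map Fin.suc ys) ⌋ then v′ else w′)
    ≡ map Fin.suc (if ⌊ x <? bottom y ys ⌋ then v else w)
if-below-map-suc x y ys v≡ w≡ with x <? bottom y ys | Fin.suc x <? bottom (Fin.suc y) (map Fin.suc ys)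
... | yes _   | yes _   = v≡
... | no _    | no _    = w≡
... | yes x<b | no x≮b  = contradiction (subst (Fin.suc x Fin.<_) (sym (bottom-map-suc y ys)) (s≤s x<b)) x≮b
... | no x≮b  | yes x<b = contradiction (s≤s⁻¹ (subst (Fin.suc x Fin.<_) (bottom-map-suc y ys) x<b)) x≮b

run-map-suc : ∀ (xs ys : List (Fin n)) → run (map Fin.suc xs) (map Fin.suc ys) ≡ map Fin.suc (run xs ys)
run-map-suc []       []       = refl
run-map-suc []       (y ∷ ys) = cong (Fin.suc y ∷_) (run-map-suc [] ys)
run-map-suc (x ∷ xs) []       = run-map-suc xs (x ∷ [])
run-map-suc (x ∷ xs) (y ∷ ys) = if-below-map-suc x y ys
  (run-map-suc xs (x ∷ y ∷ ys))
  (cong (Fin.suc y ∷_) (run-map-suc (x ∷ xs) ys))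

stackSort-map-suc : ∀ (w : List (Fin n)) → stackSort (map Fin.suc w) ≡ map Fin.suc (stackSort w)
stackSort-map-suc w = run-map-suc w []

-- Inserting a new smallest letter

-- A position beyond the end of the word counts as its end.
insertZero : ℕ → List (Fin n) → List (Fin (suc n))
insertZero zero    w       = Fin.zero ∷ map Fin.suc w
insertZero (suc p) []      = [ Fin.zero ]
insertZero (suc p) (x ∷ w) = Fin.suc x ∷ insertZero p w

length-insertZero : ∀ p (w : List (Fin n)) → length (insertZero p w) ≡ suc (length w)
length-insertZero zero    w       = cong suc (length-map Fin.suc w)
length-insertZero (suc p) []      = refl
length-insertZero (suc p) (x ∷ w) = cong suc (length-insertZero p w)

insertZero-⊓ : ∀ p (w : List (Fin n)) → insertZero (p ⊓ length w) w ≡ insertZero p w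
insertZero-⊓ zero    w       = refl
insertZero-⊓ (suc p) []      = refl
insertZero-⊓ (suc p) (x ∷ w) = cong (Fin.suc x ∷_) (insertZero-⊓ p w)

insertZero-injective-word : ∀ p q {v w : List (Fin n)} → insertZero p v ≡ insertZero q w → v ≡ w
insertZero-injective-word zero    zero    {v}     {w}     eq = map-injective Fin.suc-injective (proj₂ (∷-injective eq))
insertZero-injective-word zero    (suc q) {[]}    {[]}    eq = refl
insertZero-injective-word (suc p) zero    {[]}    {[]}    eq = refl
insertZero-injective-word (suc p) (suc q) {[]}    {[]}    eq = refl
insertZero-injective-word (suc p) (suc q) {x ∷ v} {y ∷ w} eq with ∷-injective eq
... | x≡y , eq′ = cong₂ _∷_ (Fin.suc-injective x≡y) (insertZero-injective-word p q eq′)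

-- The letter 0 occurs only once, so its position can be read off. The bounds matter because all
-- positions beyond the end give the same word.
insertZero-injective-position : ∀ {p q} (w : List (Fin n)) → p ≤ length w → q ≤ length w →
                                insertZero p w ≡ insertZero q w → p ≡ q
insertZero-injective-position {p = zero}  {zero}  w       _         _         eq = refl
insertZero-injective-position {p = zero}  {suc q} (x ∷ w) _         _         ()
insertZero-injective-position {p = suc p} {zero}  (x ∷ w) _         _         ()
insertZero-injective-position {p = suc p} {suc q} (x ∷ w) (s≤s p≤w) (s≤s q≤w) eq =
  cong suc (insertZero-injective-position w p≤w q≤w (proj₂ (∷-injective eq)))

insertZero-++ˡ : ∀ {p} (u v : List (Fin n)) → p ≤ length u →
                 insertZero p (u ++ v) ≡ insertZero p u ++ map Fin.suc v
insertZero-++ˡ {p = zero}  u       v _         = cong (Fin.zero ∷_) (map-++ Fin.suc u v)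
insertZero-++ˡ {p = suc p} (x ∷ u) v (s≤s p≤u) = cong (Fin.suc x ∷_) (insertZero-++ˡ u v p≤u)

insertZero-++ʳ : ∀ p (u v : List (Fin n)) →
                 insertZero (length u + p) (u ++ v) ≡ map Fin.suc u ++ insertZero p v
insertZero-++ʳ p []      v = refl
insertZero-++ʳ p (x ∷ u) v = cong (Fin.suc x ∷_) (insertZero-++ʳ p u v)

insertZero-ʳ++ʳ : ∀ p (u v : List (Fin n)) →
                  insertZero (length u + p) (u ʳ++ v) ≡ map Fin.suc u ʳ++ insertZero p v
insertZero-ʳ++ʳ p []      v = refl
insertZero-ʳ++ʳ p (x ∷ u) v = trans
  (cong (λ i → insertZero i (u ʳ++ (x ∷ v))) (sym (+-suc (length u) p)))
  (insertZero-ʳ++ʳ (suc p) u (x ∷ v))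

-- Reversal exchanges the numbers of letters before and behind a gap of `u`.
insertZero-ʳ++ˡ : ∀ {p} (u v : List (Fin n)) → p ≤ length u →
                  insertZero (length u ∸ p) (u ʳ++ v) ≡ insertZero p u ʳ++ map Fin.suc v
insertZero-ʳ++ˡ {p = zero}  u       v _         = trans
  (cong (λ i → insertZero i (u ʳ++ v)) (sym (+-identityʳ (length u))))
  (insertZero-ʳ++ʳ 0 u v)
insertZero-ʳ++ˡ {p = suc p} (x ∷ u) v (s≤s p≤u) = insertZero-ʳ++ˡ u (x ∷ v) p≤u

insertZero-All : ∀ {P : Fin (suc n) → Set} p {w} → P Fin.zero → All (P ∘ Fin.suc) w → All P (insertZero p w)
insertZero-All zero    p0 pw         = p0 ∷ All.map⁺ pw
insertZero-All (suc p) p0 []         = p0 ∷ []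
insertZero-All (suc p) p0 (px ∷ pw) = px ∷ insertZero-All p p0 pw

NotBelow-map-suc : ∀ {m : Fin n} {xs} → NotBelow m xs → NotBelow (Fin.suc m) (map Fin.suc xs)
NotBelow-map-suc []         = []
NotBelow-map-suc (m≤x ∷ xs) = s≤s m≤x ∷ map Fin.suc xs

-- Moving the smallest letter through the stack

-- source w p is the nonzero position from which stackSort moves the smallest
-- letter to position p. In sourceFrom m k xs p, the word consists of m,
-- followed by k letters of its block, followed by xs.
sourceFrom : Fin n → ℕ → List (Fin n) → ℕ → ℕ
sourceFrom m k []       p = suc (k ∸ p)
sourceFrom m k (x ∷ xs) p with x <? m | p ≤? k
... | yes _ | _     = sourceFrom m (suc k) xs p
... | no _  | yes _ = suc (k ∸ p)
... | no _  | no _  = suc k + sourceFrom x 0 xs (p ∸ suc k)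

source : List (Fin n) → ℕ → ℕ
source []       p = zero
source (m ∷ xs) p = sourceFrom m 0 xs p

sourceFrom-positive : ∀ (m : Fin n) k xs p → 0 < sourceFrom m k xs p
sourceFrom-positive m k []       p = s≤s z≤n
sourceFrom-positive m k (x ∷ xs) p with x <? m | p ≤? k
... | yes _ | _     = sourceFrom-positive m (suc k) xs p
... | no _  | yes _ = s≤s z≤n
... | no _  | no _  = s≤s z≤n

source-positive : ∀ (w : List (Fin n)) {p} → p < length w → 0 < source w p
source-positive (m ∷ xs) {p} _ = sourceFrom-positive m 0 xs p

-- The new letter is below `m`, so it is pushed like the others and `insertZero p B` is again a
-- block on `m`. The `suc` steps over `m`; the subtraction reflects the reversal of the block.
stackSort-insertZero-block : ∀ {m : Fin n} {xs p} B → All (Fin._< m) B → NotBelow m xs → p ≤ length B →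
  stackSort (insertZero (suc (length B ∸ p)) (m ∷ B ʳ++ xs)) ≡ insertZero p (stackSort (m ∷ B ʳ++ xs))
stackSort-insertZero-block {m = m} {xs} {p} B B<m m≤xs p≤B = begin
  stackSort (Fin.suc m ∷ insertZero (length B ∸ p) (B ʳ++ xs))
    ≡⟨ cong (λ v → stackSort (Fin.suc m ∷ v)) (insertZero-ʳ++ˡ B xs p≤B) ⟩
  stackSort (Fin.suc m ∷ insertZero p B ʳ++ map Fin.suc xs)
    ≡⟨ stackSort-block (insertZero p B) (insertZero-All p (s≤s z≤n) (All.map s≤s B<m)) (NotBelow-map-suc m≤xs) ⟩
  insertZero p B ++ Fin.suc m ∷ stackSort (map Fin.suc xs)
    ≡⟨ cong (λ v → insertZero p B ++ Fin.suc m ∷ v) (stackSort-map-suc xs) ⟩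
  insertZero p B ++ map Fin.suc (m ∷ stackSort xs)
    ≡⟨ insertZero-++ˡ B (m ∷ stackSort xs) p≤B ⟨
  insertZero p (B ++ m ∷ stackSort xs)
    ≡⟨ cong (insertZero p) (stackSort-block B B<m m≤xs) ⟨
  insertZero p (stackSort (m ∷ B ʳ++ xs)) ∎
  where open ≡-Reasoning

NotBelow-insertZero : ∀ {m x : Fin n} {p} xs → 0 < p → m Fin.≤ x →
                      NotBelow (Fin.suc m) (insertZero p (x ∷ xs))
NotBelow-insertZero {p = suc p} xs _ m≤x = s≤s m≤x ∷ insertZero p xs

-- As `0 < p`, the letter `x` still closes the block of `m`, whose `suc (length B)` letters shift
-- both positions alike. At position 0 of the rest, the new letter would join that block instead.
stackSort-insertZero-rest : ∀ {m x : Fin n} {xs p q} B → All (Fin._< m) B → m Fin.≤ x → 0 < p →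
  stackSort (insertZero p (x ∷ xs)) ≡ insertZero q (stackSort (x ∷ xs)) →
  stackSort (insertZero (suc (length B) + p) (m ∷ B ʳ++ (x ∷ xs)))
    ≡ insertZero (suc (length B) + q) (stackSort (m ∷ B ʳ++ (x ∷ xs)))
stackSort-insertZero-rest {m = m} {x} {xs} {p} {q} B B<m m≤x 0<p eq = begin
  stackSort (Fin.suc m ∷ insertZero (length B + p) (B ʳ++ (x ∷ xs)))
    ≡⟨ cong (λ v → stackSort (Fin.suc m ∷ v)) (insertZero-ʳ++ʳ p B (x ∷ xs)) ⟩
  stackSort (Fin.suc m ∷ map Fin.suc B ʳ++ insertZero p (x ∷ xs))
    ≡⟨ stackSort-block (map Fin.suc B) (All.map⁺ (All.map s≤s B<m)) (NotBelow-insertZero xs 0<p m≤x) ⟩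
  map Fin.suc B ++ Fin.suc m ∷ stackSort (insertZero p (x ∷ xs))
    ≡⟨ cong (λ v → map Fin.suc B ++ Fin.suc m ∷ v) eq ⟩
  map Fin.suc B ++ insertZero (suc q) (m ∷ stackSort (x ∷ xs))
    ≡⟨ insertZero-++ʳ (suc q) B (m ∷ stackSort (x ∷ xs)) ⟨
  insertZero (length B + suc q) (B ++ m ∷ stackSort (x ∷ xs))
    ≡⟨ cong₂ insertZero (sym (+-suc (length B) q)) (stackSort-block B B<m (m≤x ∷ xs)) ⟨
  insertZero (suc (length B) + q) (stackSort (m ∷ B ʳ++ (x ∷ xs))) ∎
  where open ≡-Reasoning

stackSort-sourceFrom : ∀ (m : Fin n) B xs p → All (Fin._< m) B → p ≤ length B + length xs →
  stackSort (insertZero (sourceFrom m (length B) xs p) (m ∷ B ʳ++ xs))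
    ≡ insertZero p (stackSort (m ∷ B ʳ++ xs))
stackSort-sourceFrom m B [] p B<m p≤ =
  stackSort-insertZero-block B B<m [] (subst (p ≤_) (+-identityʳ (length B)) p≤)
stackSort-sourceFrom m B (x ∷ xs) p B<m p≤ with x <? m | p ≤? length B
... | yes x<m | _       = stackSort-sourceFrom m (x ∷ B) xs p (x<m ∷ B<m)
                            (subst (p ≤_) (+-suc (length B) (length xs)) p≤)
... | no x≮m  | yes p≤B = stackSort-insertZero-block B B<m (≮⇒≥ x≮m ∷ xs) p≤B
-- Here `x` opens the next block, and `q` is the target position counted from there.
... | no x≮m  | no p≰B  = trans
  (stackSort-insertZero-rest B B<m (≮⇒≥ x≮m) (sourceFrom-positive x 0 xs q)
    (stackSort-sourceFrom x [] xs q [] q≤xs))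
  (cong (λ i → insertZero i (stackSort (m ∷ B ʳ++ (x ∷ xs)))) (m+[n∸m]≡n (≰⇒> p≰B)))
  where
  q = p ∸ suc (length B)

  q≤xs : q ≤ length xs
  q≤xs = m≤n+o⇒m∸n≤o p (suc (length B)) (subst (p ≤_) (+-suc (length B) (length xs)) p≤)

stackSort-source : ∀ (w : List (Fin n)) {p} → p < length w →
                   stackSort (insertZero (source w p) w) ≡ insertZero p (stackSort w)
stackSort-source (m ∷ xs) {p} (s≤s p≤xs) = stackSort-sourceFrom m [] xs p [] p≤xs

-- Nothing is smaller than 0, so a leading 0 is a block of its own.
stackSort-insertZero-0 : ∀ (w : List (Fin n)) → stackSort (insertZero 0 w) ≡ insertZero 0 (stackSort w)
stackSort-insertZero-0 w = trans
  (stackSort-block [] [] (zero-notBelow (map Fin.suc w)))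
  (cong (Fin.zero ∷_) (stackSort-map-suc w))

-- The first letter of `v` is below neither `m` nor any letter of `u`, so it closes whatever block
-- is open. No block straddles the two parts, and a target position in the first part has its source
-- there or at its end.
sourceFrom-bound : ∀ (m : Fin n) k u v p → NotBelow m v → All (λ x → NotBelow x v) u →
                   p ≤ k + length u → sourceFrom m k (u ++ v) p ≤ suc (k + length u)
sourceFrom-bound m k [] [] p _ _ _ = s≤s (≤-trans (m∸n≤m k p) (m≤m+n k 0))
sourceFrom-bound m k [] (x ∷ v) p (m≤x ∷ _) _ p≤ with x <? m | p ≤? k
... | yes x<m | _      = contradiction m≤x (<⇒≱ x<m)
... | no _    | yes _  = s≤s (≤-trans (m∸n≤m k p) (m≤m+n k 0))
... | no _    | no p≰k = contradiction (subst (p ≤_) (+-identityʳ k) p≤) p≰k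
sourceFrom-bound m k (y ∷ u) v p m≤v (y≤v ∷ u≤v) p≤ with y <? m | p ≤? k
... | yes _ | _     = subst (λ i → sourceFrom m (suc k) (u ++ v) p ≤ suc i) (sym (+-suc k (length u)))
                        (sourceFrom-bound m (suc k) u v p m≤v u≤v (subst (p ≤_) (+-suc k (length u)) p≤))
... | no _  | yes _ = s≤s (≤-trans (m∸n≤m k p) (m≤m+n k _))
... | no _  | no _  = s≤s (+-monoʳ-≤ k (sourceFrom-bound y 0 u v (p ∸ suc k) y≤v u≤v
                        (m≤n+o⇒m∸n≤o p (suc k) (subst (p ≤_) (+-suc k (length u)) p≤))))

-- A block boundary: if a letter follows, no earlier letter exceeds it.
data Cut : ℕ → List (Fin n) → Set where
  cut : ∀ {u v : List (Fin n)} → All (λ x → NotBelow x v) u → Cut (length u) (u ++ v)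

source-bound : ∀ {i p} {w : List (Fin n)} → Cut i w → p < i → source w p ≤ i
source-bound (cut {u = x ∷ u} {v} (x≤v ∷ u≤v)) (s≤s p≤) = sourceFrom-bound x 0 u v _ x≤v u≤v p≤

-- The new letter joins the left part and, being smallest, cannot exceed the first letter of the
-- right part.
Cut-insertZero : ∀ {i p} {w : List (Fin n)} → Cut i w → p ≤ i → Cut (suc i) (insertZero p w)
Cut-insertZero {p = p} (cut {u = u} {v} u≤v) p≤u = subst₂ Cut
  (length-insertZero p u) (sym (insertZero-++ˡ u v p≤u))
  (cut (insertZero-All p (zero-notBelow (map Fin.suc v)) (All.map NotBelow-map-suc u≤v)))

-- Codes

-- For k ≤ |w|, the position from which 0 needs exactly k steps to get to
-- the front.
place : List (Fin n) → ℕ → ℕ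
place w zero    = zero
place w (suc k) = source w (place (stackSort w) k)

-- Head first, the entries of a code belong to the letters in increasing order.
word : Vec ℕ n → List (Fin n)
word []       = []
word (c ∷ cs) = insertZero (place (word cs) c) (word cs)

-- The bound on an entry depends on the number of larger letters. The choice `id` gives the codes of
-- all permutations, `_∸ j` those of the `j`-fold images, `_⊓ t` those of the `t`-stack-sortable
-- permutations.
data Bounded (b : ℕ → ℕ) : Vec ℕ n → Set where
  []  : Bounded b []
  _∷_ : ∀ {c} {cs : Vec ℕ n} → c ≤ b n → Bounded b cs → Bounded b (c ∷ cs)

Bounded-mono : ∀ {b b′ : ℕ → ℕ} {cs : Vec ℕ n} → (∀ i → b i ≤ b′ i) → Bounded b cs → Bounded b′ cs
Bounded-mono b≤b′ []            = []
Bounded-mono b≤b′ (c≤ ∷ cs≤) = ≤-trans c≤ (b≤b′ _) ∷ Bounded-mono b≤b′ cs≤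

Bounded-pred : ∀ j {cs : Vec ℕ n} → Bounded (_∸ j) cs → Bounded (_∸ suc j) (Vec.map pred cs)
Bounded-pred j []                           = []
Bounded-pred j {c ∷ _} (_∷_ {n} c≤ cs≤) =
  subst (pred c ≤_) (pred[m∸n]≡m∸[1+n] n j) (pred-mono-≤ c≤) ∷ Bounded-pred j cs≤

Bounded-∸ : ∀ t {cs : Vec ℕ n} → Bounded id cs → Bounded id (Vec.map (_∸ t) cs)
Bounded-∸ t []                      = []
Bounded-∸ t {c ∷ _} (c≤ ∷ cs≤) = ≤-trans (m∸n≤m c t) c≤ ∷ Bounded-∸ t cs≤

Bounded-zeros : ∀ {b} n → Bounded b (Vec.replicate n 0)
Bounded-zeros zero    = []
Bounded-zeros (suc n) = z≤n ∷ Bounded-zeros n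

length-word : ∀ (cs : Vec ℕ n) → length (word cs) ≡ n
length-word []       = refl
length-word (c ∷ cs) = trans (length-insertZero (place (word cs) c) (word cs)) (cong suc (length-word cs))

-- After j steps the j largest letters are in place at the end, so the smallest
-- letter can stand behind them only if it is further than |w| - j steps from
-- the front.
place-bound : ∀ {n} j k {cs : Vec ℕ n} → Bounded (_∸ j) cs → k ≤ n ∸ j → place (word cs) k ≤ n ∸ j

-- A letter with at least `j` larger ones is inserted no later than the cut, by `place-bound`, and
-- moves it one place to the right. With fewer larger ones, the cut is at 0.
Cut-word : ∀ {n} j {cs : Vec ℕ n} → Bounded (_∸ j) cs → Cut (n ∸ j) (word cs)

-- By `stackSort-source`, inserting at `place w (suc c)` and then sorting amounts to sorting `w` and
-- inserting at `place (stackSort w) c`. An entry 0 stands for the front, which is fixed.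
stackSort-word : ∀ {n} {cs : Vec ℕ n} → Bounded id cs → stackSort (word cs) ≡ word (Vec.map pred cs)

-- The code of the sorted word obeys the bound `_∸ suc j`, so `place-bound` improves by one;
-- `k < n ∸ j` ensures that truncation does not swallow the gain.
place-pred-bound : ∀ {n} j k {cs : Vec ℕ n} → Bounded (_∸ j) cs → k < n ∸ j →
                   place (stackSort (word cs)) k < n ∸ j

place-bound     j zero    cs≤ k≤ = z≤n
-- The mutual recursion is on the length `n` first, then on `k`: sorting keeps `n` while `k` drops,
-- and `Cut-word` passes to shorter codes.
place-bound     j (suc k) cs≤ k≤ = source-bound (Cut-word j cs≤) (place-pred-bound j k cs≤ k≤)

Cut-word         zero    {[]} cs≤ = cut []
Cut-word         (suc j) {[]} cs≤ = cut []
Cut-word {suc n} j {c ∷ cs} (c≤ ∷ cs≤) with j ≤? n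
... | yes j≤n rewrite +-∸-assoc 1 j≤n = Cut-insertZero (Cut-word j cs≤) (place-bound j c cs≤ c≤)
... | no j≰n  rewrite m≤n⇒m∸n≡0 (≰⇒> j≰n) = cut []

stackSort-word         {cs = []}        []          = refl
stackSort-word {suc n} {cs = zero ∷ cs} (_ ∷ cs≤) =
  trans (stackSort-insertZero-0 (word cs)) (cong (insertZero 0) (stackSort-word cs≤))
stackSort-word {suc n} {cs = suc c ∷ cs} (c≤ ∷ cs≤) = trans
  (stackSort-source (word cs)
    (subst (place (stackSort (word cs)) c <_) (sym (length-word cs)) (place-pred-bound 0 c cs≤ c≤)))
  (cong (λ v → insertZero (place v c) v) (stackSort-word cs≤))

place-pred-bound {n} j k {cs} cs≤ k< = begin-strict
  place (stackSort (word cs)) k      ≡⟨ cong (λ v → place v k) (stackSort-word (Bounded-mono (λ i → m∸n≤m i j) cs≤)) ⟩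
  place (word (Vec.map pred cs)) k   ≤⟨ place-bound (suc j) k (Bounded-pred j cs≤) k≤ ⟩
  n ∸ suc j                          <⟨ ∸-monoʳ-< (n<1+n j) (m∸n≢0⇒n<m (m<n⇒n≢0 k<)) ⟩
  n ∸ j                              ∎
  where
  open ≤-Reasoning
  k≤ : k ≤ n ∸ suc j
  k≤ = subst (k ≤_) (pred[m∸n]≡m∸[1+n] n j) (<⇒≤pred k<)

place-pred-length : ∀ j k {cs : Vec ℕ n} → Bounded (_∸ j) cs → k < n ∸ j →
                    place (stackSort (word cs)) k < length (word cs)
place-pred-length {n} j k {cs} cs≤ k< = subst (place (stackSort (word cs)) k <_) (sym (length-word cs))
  (<-≤-trans (place-pred-bound j k cs≤ k<) (m∸n≤m n j))

place-suc-positive : ∀ j k {cs : Vec ℕ n} → Bounded (_∸ j) cs → k < n ∸ j → 0 < place (word cs) (suc k)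
place-suc-positive j k {cs} cs≤ k< = source-positive (word cs) (place-pred-length j k cs≤ k<)

-- Applying `stackSort` to both insertions undoes `source` and reduces the claim to the sorted word,
-- with `k` and `l` lowered. The index `j` counts the steps made so far.
place-injective : ∀ j {k l} {cs : Vec ℕ n} → Bounded (_∸ j) cs → k ≤ n ∸ j → l ≤ n ∸ j →
                  place (word cs) k ≡ place (word cs) l → k ≡ l
place-injective j {zero}  {zero}  cs≤ k≤ l≤ eq = refl
place-injective j {zero}  {suc l} cs≤ k≤ l≤ eq = contradiction eq (<⇒≢ (place-suc-positive j l cs≤ l≤))
place-injective j {suc k} {zero}  cs≤ k≤ l≤ eq = contradiction (sym eq) (<⇒≢ (place-suc-positive j k cs≤ k≤))
place-injective {n} j {suc k} {suc l} {cs} cs≤ k≤ l≤ eq =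
  cong suc (place-injective (suc j) (Bounded-pred j cs≤) (shift k≤) (shift l≤)
    (subst (λ v → place v k ≡ place v l) sorted
      (insertZero-injective-position (stackSort w) (inside k≤) (inside l≤) (begin
        insertZero (place (stackSort w) k) (stackSort w)  ≡⟨ stackSort-source w (place-pred-length j k cs≤ k≤) ⟨
        stackSort (insertZero (place w (suc k)) w)        ≡⟨ cong (λ p → stackSort (insertZero p w)) eq ⟩
        stackSort (insertZero (place w (suc l)) w)        ≡⟨ stackSort-source w (place-pred-length j l cs≤ l≤) ⟩
        insertZero (place (stackSort w) l) (stackSort w)  ∎))))
  where
  open ≡-Reasoning
  w = word cs

  sorted : stackSort w ≡ word (Vec.map pred cs)
  sorted = stackSort-word (Bounded-mono (λ i → m∸n≤m i j) cs≤)

  shift : ∀ {k} → k < n ∸ j → k ≤ n ∸ suc j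
  shift {k} k< = subst (k ≤_) (pred[m∸n]≡m∸[1+n] n j) (<⇒≤pred k<)

  inside : ∀ {k} → k < n ∸ j → place (stackSort w) k ≤ length (stackSort w)
  inside {k} k< = subst (place (stackSort w) k ≤_)
    (sym (trans (cong length sorted) (length-word (Vec.map pred cs))))
    (≤-trans (<⇒≤ (place-pred-bound j k cs≤ k<)) (m∸n≤m n j))

word-injective : ∀ {cs ds : Vec ℕ n} → Bounded id cs → Bounded id ds → word cs ≡ word ds → cs ≡ ds
word-injective {cs = []}     {[]}     []          []          eq = refl
word-injective {cs = c ∷ cs} {d ∷ ds} (c≤ ∷ cs≤) (d≤ ∷ ds≤) eq
  -- Once the codes of the larger letters agree, both positions refer to the same word.
  with refl ← word-injective cs≤ ds≤ (insertZero-injective-word (place (word cs) c) (place (word ds) d) eq) =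
  cong (_∷ cs) (place-injective 0 cs≤ c≤ d≤
    (insertZero-injective-position (word cs) (inside c≤) (inside d≤) eq))
  where
  inside : ∀ {k} → k ≤ _ → place (word cs) k ≤ length (word cs)
  inside {k} k≤ = subst (place (word cs) k ≤_) (sym (length-word cs)) (place-bound 0 k cs≤ k≤)

-- Sortability read off from codes

iterate-word : ∀ t {cs : Vec ℕ n} → Bounded id cs → fold (word cs) stackSort t ≡ word (Vec.map (_∸ t) cs)
iterate-word zero    {cs} cs≤ = cong word (sym (Vec.map-id cs))
iterate-word (suc t) {cs} cs≤ = begin
  stackSort (fold (word cs) stackSort t)    ≡⟨ cong stackSort (iterate-word t cs≤) ⟩
  stackSort (word (Vec.map (_∸ t) cs))      ≡⟨ stackSort-word (Bounded-∸ t cs≤) ⟩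
  word (Vec.map pred (Vec.map (_∸ t) cs))   ≡⟨ cong word (Vec.map-∘ pred (_∸ t) cs) ⟨
  word (Vec.map (pred ∘ (_∸ t)) cs)         ≡⟨ cong word (Vec.map-cong (λ c → pred[m∸n]≡m∸[1+n] c t) cs) ⟩
  word (Vec.map (_∸ suc t) cs)              ∎
  where open ≡-Reasoning

word-zeros : ∀ n → word (Vec.replicate n 0) ≡ allFin n
word-zeros zero    = refl
word-zeros (suc n) = cong (Fin.zero ∷_) (trans (cong (map Fin.suc) (word-zeros n)) (map-tabulate id Fin.suc))

∸-zeros : ∀ {t} {cs : Vec ℕ n} → Bounded (_⊓ t) cs → Vec.map (_∸ t) cs ≡ Vec.replicate n 0
∸-zeros []                        = refl
∸-zeros {t = t} (_∷_ {n} c≤ cs≤) = cong₂ _∷_ (m≤n⇒m∸n≡0 (≤-trans c≤ (m⊓n≤n n t))) (∸-zeros cs≤)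

∸-zeros⁻¹ : ∀ {t} {cs : Vec ℕ n} → Bounded id cs → Vec.map (_∸ t) cs ≡ Vec.replicate n 0 → Bounded (_⊓ t) cs
∸-zeros⁻¹ []         eq = []
∸-zeros⁻¹ (c≤ ∷ cs≤) eq with Vec.∷-injective eq
... | c∸t≡0 , eq′ = ⊓-glb c≤ (m∸n≡0⇒m≤n c∸t≡0) ∷ ∸-zeros⁻¹ cs≤ eq′

⊓-bounded : ∀ {t} {cs : Vec ℕ n} → Bounded (_⊓ t) cs → Bounded id cs
⊓-bounded {t = t} = Bounded-mono (λ i → m⊓n≤m i t)

word-sortable : ∀ {t} {cs : Vec ℕ n} → Bounded (_⊓ t) cs → fold (word cs) stackSort t ≡ allFin n
word-sortable {n} {t} cs≤ =
  trans (iterate-word t (⊓-bounded cs≤)) (trans (cong word (∸-zeros cs≤)) (word-zeros n))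

-- Since `word` is injective on bounded codes, only the zero code gives the identity.
word-sortable⁻¹ : ∀ {t} {cs : Vec ℕ n} → Bounded id cs → fold (word cs) stackSort t ≡ allFin n → Bounded (_⊓ t) cs
word-sortable⁻¹ {n} {t} cs≤ eq = ∸-zeros⁻¹ cs≤ (word-injective (Bounded-∸ t cs≤) (Bounded-zeros n)
  (trans (sym (iterate-word t cs≤)) (trans eq (sym (word-zeros n)))))

-- Codes of permutations

tabulate-injective : ∀ {A : Set} {f g : Fin n → A} → tabulate f ≡ tabulate g → f ≗ g
tabulate-injective eq Fin.zero    = proj₁ (∷-injective eq)
tabulate-injective eq (Fin.suc i) = tabulate-injective (proj₂ (∷-injective eq)) i

-- The common core of `oneLine-insert` and `oneLine-remove`: `g` is `f` with its value 0 at `i`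
-- deleted and the other values lowered.
tabulate-insertZero : ∀ (f : Fin (suc m) → Fin (suc n)) (g : Fin m → Fin n) i → f i ≡ Fin.zero →
                      (∀ k → f (punchIn i k) ≡ Fin.suc (g k)) →
                      tabulate f ≡ insertZero (toℕ i) (tabulate g)
tabulate-insertZero f g Fin.zero fi≡0 f≡g =
  cong₂ _∷_ fi≡0 (trans (tabulate-cong f≡g) (sym (map-tabulate g Fin.suc)))
tabulate-insertZero {m = suc m} f g (Fin.suc i) fi≡0 f≡g =
  cong₂ _∷_ (f≡g Fin.zero) (tabulate-insertZero (f ∘ Fin.suc) (g ∘ Fin.suc) i fi≡0 (f≡g ∘ Fin.suc))

insert-hit : ∀ i (π : Permutation′ n) → Perm.insert i Fin.zero π ⟨$⟩ʳ i ≡ Fin.zero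
insert-hit i π with i Fin.≟ i
... | yes _  = refl
... | no i≢i = contradiction refl i≢i

oneLine-insert : ∀ i (π : Permutation′ n) →
                 oneLine (Perm.insert i Fin.zero π) ≡ insertZero (toℕ i) (oneLine π)
oneLine-insert i π = tabulate-insertZero (Perm.insert i Fin.zero π ⟨$⟩ʳ_) _ i (insert-hit i π) (Perm.insert-punchIn i Fin.zero π)

oneLine-remove : ∀ (π : Permutation′ (suc n)) → let i = π ⟨$⟩ˡ Fin.zero in
                 oneLine π ≡ insertZero (toℕ i) (oneLine (Perm.remove i π))
oneLine-remove π = tabulate-insertZero (π ⟨$⟩ʳ_) _ _ (Perm.inverseʳ π) (Perm.punchIn-permute′ π Fin.zero)

-- Makes `permutationOf` total on all codes. As `insertZero` treats a larger position as the end,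
-- clamping changes no word.
clamp : ∀ n → ℕ → Fin (suc n)
clamp n p = fromℕ< (s≤s (m⊓n≤n p n))

toℕ-clamp : ∀ n p → toℕ (clamp n p) ≡ p ⊓ n
toℕ-clamp n p = Fin.toℕ-fromℕ< (s≤s (m⊓n≤n p n))

permutationOf : Vec ℕ n → Permutation′ n
permutationOf []                 = Perm.id
permutationOf (_∷_ {n = n} c cs) = Perm.insert (clamp n (place (word cs) c)) Fin.zero (permutationOf cs)

oneLine-permutationOf : ∀ (cs : Vec ℕ n) → oneLine (permutationOf cs) ≡ word cs
oneLine-permutationOf []                 = refl
oneLine-permutationOf (_∷_ {n = n} c cs) = begin
  oneLine (permutationOf (c ∷ cs))                      ≡⟨ oneLine-insert (clamp n p) (permutationOf cs) ⟩
  insertZero (toℕ (clamp n p)) (oneLine (permutationOf cs))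
    ≡⟨ cong₂ insertZero (toℕ-clamp n p) (oneLine-permutationOf cs) ⟩
  insertZero (p ⊓ n) (word cs)                 ≡⟨ cong (λ i → insertZero (p ⊓ i) (word cs)) (length-word cs) ⟨
  insertZero (p ⊓ length (word cs)) (word cs)  ≡⟨ insertZero-⊓ p (word cs) ⟩
  insertZero p (word cs)                       ∎
  where
  open ≡-Reasoning
  p = place (word cs) c

-- Pigeonhole: if `j` were missed, `punchOut` would squeeze `Fin (suc n)` injectively into `Fin n`.
injective⇒hits : ∀ {f : Fin n → Fin n} → Injective _≡_ _≡_ f → ∀ j → ∃ λ i → f i ≡ j
injective⇒hits {suc n} {f} f-injective j with Fin.any? (λ i → f i Fin.≟ j)
... | yes hit = hit
... | no miss = contradiction
  (Fin.injective⇒≤ {f = λ i → punchOut (j≢f i)}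
    (λ {i} {i′} eq → f-injective (Fin.punchOut-injective (j≢f i) (j≢f i′) eq)))
  1+n≰n
  where
  j≢f : ∀ i → j ≢ f i
  j≢f i j≡fi = miss (i , sym j≡fi)

-- On the numbers up to `n`, `place` is an injection into the `n + 1` positions, so it hits them
-- all.
place-surjective : ∀ {cs : Vec ℕ n} → Bounded id cs → ∀ (i : Fin (suc n)) →
                   ∃ λ c → c ≤ n × place (word cs) c ≡ toℕ i
place-surjective {n} {cs} cs≤ i with injective⇒hits position-injective i
  where
  position : Fin (suc n) → Fin (suc n)
  position c = fromℕ< (s≤s (place-bound 0 (toℕ c) cs≤ (Fin.toℕ≤pred[n] c)))

  position-injective : Injective _≡_ _≡_ position
  position-injective {c} {d} eq = Fin.toℕ-injective
    (place-injective 0 cs≤ (Fin.toℕ≤pred[n] c) (Fin.toℕ≤pred[n] d) (Fin.fromℕ<-injective _ _ _ _ eq))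
... | c , refl = toℕ c , Fin.toℕ≤pred[n] c , sym (Fin.toℕ-fromℕ< _)

word-surjective : ∀ (π : Permutation′ n) → ∃ λ cs → Bounded id cs × word cs ≡ oneLine π
word-surjective {zero}  π = [] , [] , refl
word-surjective {suc n} π
  with cs , cs≤ , word≡ ← word-surjective (Perm.remove (π ⟨$⟩ˡ Fin.zero) π)
  with c , c≤ , place≡ ← place-surjective cs≤ (π ⟨$⟩ˡ Fin.zero) =
  c ∷ cs , c≤ ∷ cs≤ , trans (cong₂ insertZero place≡ word≡) (sym (oneLine-remove π))

-- Counting codes

codeCount : (ℕ → ℕ) → ℕ → ℕ
codeCount b zero    = 1
codeCount b (suc n) = suc (b n) * codeCount b n

-- Mixed-radix expansion, the leading digit having `suc (b n)` possible values.
digits : ∀ b n → Fin (codeCount b n) → Vec ℕ n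
digits b zero    _ = []
digits b (suc n) i with remQuot {suc (b n)} (codeCount b n) i
... | c , i′ = toℕ c ∷ digits b n i′

digits-bounded : ∀ b n i → Bounded b (digits b n i)
digits-bounded b zero    i = []
digits-bounded b (suc n) i = Fin.toℕ≤pred[n] _ ∷ digits-bounded b n _

digits-injective : ∀ b n {i j} → digits b n i ≡ digits b n j → i ≡ j
digits-injective b zero    {Fin.zero} {Fin.zero} eq = refl
digits-injective b (suc n) {i} {j} eq with Vec.∷-injective eq
... | c≡d , eq′ = begin
  i                                                ≡⟨ Fin.combine-remQuot {suc (b n)} N i ⟨
  combine (proj₁ (remQuot N i)) (proj₂ (remQuot {suc (b n)} N i))
    ≡⟨ cong₂ combine (Fin.toℕ-injective c≡d) (digits-injective b n eq′) ⟩
  combine (proj₁ (remQuot N j)) (proj₂ (remQuot {suc (b n)} N j))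
    ≡⟨ Fin.combine-remQuot {suc (b n)} N j ⟩
  j                                                ∎
  where
  open ≡-Reasoning
  N = codeCount b n

digits-surjective : ∀ {b} {cs : Vec ℕ n} → Bounded b cs → ∃ λ i → digits b n i ≡ cs
digits-surjective [] = Fin.zero , refl
digits-surjective {b = b} (_∷_ {n} c≤ cs≤) with i , refl ← digits-surjective cs≤ =
  combine (fromℕ< (s≤s c≤)) i ,
  trans
    (cong (λ (c , i′) → toℕ c ∷ digits b n i′) (Fin.remQuot-combine (fromℕ< (s≤s c≤)) i))
    (cong (_∷ digits b n i) (Fin.toℕ-fromℕ< (s≤s c≤)))

codeCount-≤ : ∀ {n t} → n ≤ t → codeCount (_⊓ t) n ≡ n !
codeCount-≤ {zero}  n≤t = refl
codeCount-≤ {suc n} n<t = cong₂ (λ k N → suc k * N) (m≤n⇒m⊓n≡m (<⇒≤ n<t)) (codeCount-≤ (<⇒≤ n<t))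

-- The first `t` factors are 1, ..., `t` and multiply to `t !`; each of the other `d` equals
-- `t + 1`.
codeCount-+ : ∀ t d → codeCount (_⊓ t) (d + t) ≡ t ! * (t + 1) ^ d
codeCount-+ t zero    = trans (codeCount-≤ {t} ≤-refl) (sym (*-identityʳ (t !)))
codeCount-+ t (suc d) = begin
  suc ((d + t) ⊓ t) * codeCount (_⊓ t) (d + t)
    ≡⟨ cong₂ (λ k N → suc k * N) (m≥n⇒m⊓n≡n (m≤n+m t d)) (codeCount-+ t d) ⟩
  suc t * (t ! * (t + 1) ^ d)    ≡⟨ cong (_* (t ! * (t + 1) ^ d)) (+-comm 1 t) ⟩
  (t + 1) * (t ! * (t + 1) ^ d)  ≡⟨ *-assoc (t + 1) (t !) _ ⟨
  (t + 1) * t ! * (t + 1) ^ d    ≡⟨ cong (_* (t + 1) ^ d) (*-comm (t + 1) (t !)) ⟩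
  t ! * (t + 1) * (t + 1) ^ d    ≡⟨ *-assoc (t !) (t + 1) _ ⟩
  t ! * (t + 1) ^ suc d          ∎
  where open ≡-Reasoning

sortable-cardinality : ∀ n t → HasCardinality (sortableSetoid n t) (codeCount (_⊓ t) n)
sortable-cardinality n t = Bijection⇒Inverse (record
  { to        = λ i → permutationOf (code i) , sortable i
  ; cong      = λ { refl _ → refl }
  ; bijective = injective , λ (π , π-sortable) → surjective π π-sortable
  })
  where
  code = digits (_⊓ t) n

  sortable : ∀ i → StackSortable t (permutationOf (code i))
  sortable i rewrite oneLine-permutationOf (code i) = word-sortable (digits-bounded (_⊓ t) n i)

  injective : ∀ {i j} → permutationOf (code i) ≈ permutationOf (code j) → i ≡ j
  injective {i} {j} eq = digits-injective (_⊓ t) n (word-injective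
    (⊓-bounded (digits-bounded (_⊓ t) n i)) (⊓-bounded (digits-bounded (_⊓ t) n j))
    (trans (sym (oneLine-permutationOf (code i)))
      (trans (tabulate-cong eq) (oneLine-permutationOf (code j)))))

  surjective : ∀ π → StackSortable t π → ∃ λ i → ∀ {k} → k ≡ i → permutationOf (code k) ≈ π
  surjective π π-sortable
    -- Every `π` has a code; sortability bounds its entries by `t`, which puts it in the range of
    -- `code`.
    with cs , cs≤ , word≡π ← word-surjective π
    with i , refl ← digits-surjective (word-sortable⁻¹ {t = t} cs≤
                      (trans (cong (λ w → fold w stackSort t) word≡π) π-sortable)) =
    i , λ { refl → tabulate-injective (trans (oneLine-permutationOf (code i)) word≡π) }

theorem3p4 : (n t : ℕ) → 1 ≤ n →
    (n ≤ t → HasCardinality (sortableSetoid n t) (n !)) ×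
    (t < n → HasCardinality (sortableSetoid n t) (t ! * (t + 1) ^ (n ∸ t)))
theorem3p4 n t _ =
  (λ n≤t → subst (HasCardinality (sortableSetoid n t)) (codeCount-≤ n≤t) (sortable-cardinality n t)) ,
  (λ t<n → subst (HasCardinality (sortableSetoid n t))
    (trans (cong (codeCount (_⊓ t)) (sym (m∸n+n≡m (<⇒≤ t<n)))) (codeCount-+ t (n ∸ t)))
    (sortable-cardinality n t))
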